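{- Let $E_1$ and $E_2$ be systems of relations over $S^{\pm}$ and $T^{\pm}$ respectively, where $S$ and $T$ are (possibly different) finite alphabets, such that the groups $\Gamma(E_1)$ and $\Gamma(E_2)$ are isomorphic. Then $E_1$ is testable if and only if $E_2$ is testable.
   Context: Words and relations. For a finite alphabet $S$, $S^{ - }$ is its set of formal inverses, $S^{\pm}=S\cup S^{ - }$, and $F_S$ is the free group on $S$. A system of relations $E=\{w_{i,1}=w_{i,2}\}_{i=1}^r$ over $S^{\pm}$ is a finite set of formal equations between words over $S^{\pm}$. $\Gamma(E)=\langle S\mid E\rangle$ is the finitely presented group generated by $S$ subject to the relations $E$, i.e. the quotient of $F_S$ by the normal closure of $\{w_{i,2}^{ -1}w_{i,1}\}_{i=1}^r$. $S$-graphs. An $S$-graph is a directed graph (self-loops and multiple edges allowed) with edges labelled by elements of $S$, such that for each $s\in S$ every vertex has exactly one outgoing and exactly one incoming edge labelled $s$. $s_Gx$ is the endpoint of the $s$-labelled edge leaving $x$, $s_G^{ -1}x$ the origin of the $s$-labelled edge entering $x$; for a word $w=w_t\cdots w_1$ ($w_i\in S^{\pm}$), $w_Gx=(w_t)_G(\cdots((w_1)_Gx))$. $\mathcal G_S(n)$ is the set of $S$-graphs with vertex set $[n]=\{1,\dots,n\}$ (equivalently, $|S|$-tuples of permutations of $[n]$). $\mathrm{GSol}_E(n)$ is the set of $G\in\mathcal G_S(n)$ with $(w_{i,1})_Gx=(w_{i,2})_Gx$ for all $i$ and all $x\in[n]$. For $G,G'\in\mathcal G_S(n)$, $d^{\mathrm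 H}(G,G')=\sum_{s\in S}\frac1n|\{x\in[n]: s_Gx\ne s_{G'}x\}|$, and for $\varepsilon>0$, $\mathrm{GSol}_E^{\ge\varepsilon}(n)=\{G\in\mathcal G_S(n): d^{\mathrm H}(G,G')\ge\varepsilon\ \forall G'\in\mathrm{GSol}_E(n)\}$. Testability. A (randomized, adaptive) algorithm that takes $n\in\mathbb N$ and has query access to $G\in\mathcal G_S(n)$ is an $(\varepsilon,q)$-tester for $E$ if: it accepts with probability at least $0.99$ whenever $G\in\mathrm{GSol}_E(n)$; it rejects with probability at least $0.99$ whenever $G\in\mathrm{GSol}_E^{\ge\varepsilon}(n)$; and it makes at most $q$ queries, each of the form "what is $s_Gx$?" with $x\in[n]$, $s\in S^{\pm}$. Running time is not restricted. $E$ is testable if for every $\varepsilon>0$ there are $q=q(\varepsilon)\in\mathbb N$ (independent of $n$) and an $(\varepsilon,q)$-tester for $E$. The definitions for $T$ are the same with $T$ in place of $S$. -}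

module Defs where

open import Algebra.Bundles using (Group)
open import Algebra.Morphism.Structures using (IsGroupIsomorphism)
import Algebra.Definitions.RawMonoid as RawMonoidDefinitions
import Algebra.Properties.Group as GroupProperties
open import Data.Fin.Base using (Fin)
open import Data.Fin.Permutation using (Permutation′; _⟨$⟩ʳ_; _⟨$⟩ˡ_)
open import Data.Fin.Properties using (_≟_)
open import Data.Integer.Base using (+_)
open import Data.List.Base
  using (List; []; _∷_; _++_; map; reverse; foldr; filter; length; allFin)
open import Data.List.Membership.Propositional using (_∈_)
open import Data.List.Properties
  using (++-assoc; ++-identityʳ; map-++; reverse-++)
open import Data.Nat.Base using (ℕ; suc; NonZero)
open import Data.Product.Base using (∃; ∃-syntax; _×_; _,_)
open import Data.Rational.Base
  using (ℚ; 0ℚ; 1ℚ; _/_; _*_; _≤_; _<_; +-0-rawMonoid)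
open import Function.Bundles using (_↔_; Inverse)
open import Level using (0ℓ)
open import Relation.Binary.Construct.Closure.Equivalence as Eq
  using (EqClosure)
open import Relation.Binary.Core using (Rel)
open import Relation.Binary.PropositionalEquality
  using (_≡_; refl; sym; trans; cong; subst₂)
open import Relation.Nullary.Decidable using (¬?)
open import Relation.Unary using (Pred)

open RawMonoidDefinitions +-0-rawMonoid using (sum)

------------------------------------------------------------------------
-- Alphabets, words and systems of relations

record Alphabet : Set₁ where
  field
    Letter  : Set
    size    : ℕ
    letters : Letter ↔ Fin size

open Alphabet public

data _± (A : Set) : Set where
  _⁺ : A → A ±
  _⁻ : A → A ±

flip± : ∀ {A} → A ± → A ±
flip± (a ⁺) = a ⁻
flip± (a ⁻) = a ⁺

-- The word w_t ⋯ w_1 is the list w_t ∷ ⋯ ∷ w_1 ∷ [].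
Word : Set → Set
Word A = List (A ±)

-- The pair (u , v) stands for the formal equation u = v.
System : Alphabet → Set
System S = List (Word (Letter S) × Word (Letter S))

------------------------------------------------------------------------
-- The free group

module _ {A : Set} where

  data _⟶_ : Rel (Word A) 0ℓ where
    cancel : ∀ u s v → (u ++ s ∷ flip± s ∷ v) ⟶ (u ++ v)

  _~_ : Rel (Word A) 0ℓ
  _~_ = EqClosure _⟶_

  inverse : Word A → Word A
  inverse w = map flip± (reverse w)

  private
    ~-reflexive : ∀ {u v} → u ≡ v → u ~ v
    ~-reflexive refl = Eq.reflexive _⟶_

    flip±-involutive : (s : A ±) → flip± (flip± s) ≡ s
    flip±-involutive (_ ⁺) = refl
    flip±-involutive (_ ⁻) = refl

    inverse-++ : ∀ u v → inverse (u ++ v) ≡ inverse v ++ inverse u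
    inverse-++ u v = trans (cong (map flip±) (reverse-++ u v))
                           (map-++ flip± (reverse v) (reverse u))

    inverse-∷ : ∀ s w → inverse (s ∷ w) ≡ inverse w ++ flip± s ∷ []
    inverse-∷ s w = inverse-++ (s ∷ []) w

    step-++ˡ : ∀ w {u v} → u ⟶ v → (w ++ u) ⟶ (w ++ v)
    step-++ˡ w (cancel u s v) =
      subst₂ _⟶_ (++-assoc w u _) (++-assoc w u v) (cancel (w ++ u) s v)

    step-++ʳ : ∀ w {u v} → u ⟶ v → (u ++ w) ⟶ (v ++ w)
    step-++ʳ w (cancel u s v) =
      subst₂ _⟶_ (sym (++-assoc u _ w)) (sym (++-assoc u v w))
        (cancel u s (v ++ w))

    step-inverse : ∀ {u v} → u ⟶ v → inverse u ⟶ inverse v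
    step-inverse (cancel u s v) =
      subst₂ _⟶_ (sym eq) (sym (inverse-++ u v))
        (cancel (inverse v) (flip± (flip± s)) (inverse u))
      where
      eq : inverse (u ++ s ∷ flip± s ∷ v) ≡
           inverse v ++ flip± (flip± s) ∷ flip± (flip± (flip± s)) ∷ inverse u
      eq rewrite inverse-++ u (s ∷ flip± s ∷ v)
               | inverse-∷ s (flip± s ∷ v)
               | inverse-∷ (flip± s) v
               | flip±-involutive (flip± s)
               | ++-assoc (inverse v ++ flip± (flip± s) ∷ [])
                          (flip± s ∷ []) (inverse u)
               | ++-assoc (inverse v) (flip± (flip± s) ∷ [])
                          (flip± s ∷ inverse u)
               = refl

    ++-cong : ∀ {u v x y} → u ~ v → x ~ y → (u ++ x) ~ (v ++ y)
    ++-cong {u} {v} {x} {y} p q = Eq.transitive _⟶_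
      (Eq.gmap (_++ x) (step-++ʳ x) p)
      (Eq.gmap (v ++_) (step-++ˡ v) q)

    inverse-cong : ∀ {u v} → u ~ v → inverse u ~ inverse v
    inverse-cong = Eq.gmap inverse step-inverse

    inverseʳ : ∀ w → (w ++ inverse w) ~ []
    inverseʳ []      = Eq.reflexive _⟶_
    inverseʳ (s ∷ w) = Eq.transitive _⟶_
      (~-reflexive (trans (cong ((s ∷ w) ++_) (inverse-∷ s w))
                          (cong (s ∷_) (sym (++-assoc w (inverse w) _)))))
      (Eq.transitive _⟶_
        (++-cong (Eq.reflexive _⟶_ {s ∷ []})
                 (++-cong (inverseʳ w) (Eq.reflexive _⟶_)))
        (Eq.return (cancel [] s [])))

    inverseˡ : ∀ w → (inverse w ++ w) ~ []
    inverseˡ []      = Eq.reflexive _⟶_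
    inverseˡ (s ∷ w) = Eq.transitive _⟶_
      (~-reflexive (trans (cong (_++ (s ∷ w)) (inverse-∷ s w))
                   (trans (++-assoc (inverse w) _ _)
                          (cong (λ t → inverse w ++ flip± s ∷ t ∷ w)
                                (sym (flip±-involutive s))))))
      (Eq.transitive _⟶_
        (Eq.return (cancel (inverse w) (flip± s) w))
        (inverseˡ w))

  freeGroup : Group 0ℓ 0ℓ
  freeGroup = record
    { Carrier = Word A
    ; _≈_     = _~_
    ; _∙_     = _++_
    ; ε       = []
    ; _⁻¹     = inverse
    ; isGroup = record
      { isMonoid = record
        { isSemigroup = record
          { isMagma = record
            { isEquivalence = Eq.isEquivalence _⟶_
            ; ∙-cong        = ++-cong
            }
          ; assoc = λ u v w → ~-reflexive (++-assoc u v w)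
          }
        ; identity = (λ _ → Eq.reflexive _⟶_)
                   , (λ w → ~-reflexive (++-identityʳ w))
        }
      ; inverse = inverseˡ , inverseʳ
      ; ⁻¹-cong = inverse-cong
      }
    }

------------------------------------------------------------------------
-- Normal closures and quotients

module _ (G : Group 0ℓ 0ℓ) where
  open Group G

  data NormalClosure (P : Pred Carrier 0ℓ) : Pred Carrier 0ℓ where
    generator : ∀ {g} → P g → NormalClosure P g
    resp      : ∀ {g h} → g ≈ h → NormalClosure P g → NormalClosure P h
    unit      : NormalClosure P ε
    mul       : ∀ {g h} → NormalClosure P g → NormalClosure P h →
                NormalClosure P (g ∙ h)
    inv       : ∀ {g} → NormalClosure P g → NormalClosure P (g ⁻¹)
    conj      : ∀ h {g} → NormalClosure P g →
                NormalClosure P (h ∙ g ∙ h ⁻¹)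

  quotient : Pred Carrier 0ℓ → Group 0ℓ 0ℓ
  quotient P = record
    { Carrier = Carrier
    ; _≈_     = _≈ₙ_
    ; _∙_     = _∙_
    ; ε       = ε
    ; _⁻¹     = _⁻¹
    ; isGroup = record
      { isMonoid = record
        { isSemigroup = record
          { isMagma = record
            { isEquivalence = record
              { refl  = ≈⇒≈ₙ ≈-refl
              ; sym   = ≈ₙ-sym
              ; trans = ≈ₙ-trans
              }
            ; ∙-cong = ≈ₙ-∙-cong
            }
          ; assoc = λ x y z → ≈⇒≈ₙ (assoc x y z)
          }
        ; identity = (λ x → ≈⇒≈ₙ (identityˡ x)) , (λ x → ≈⇒≈ₙ (identityʳ x))
        }
      ; inverse = (λ x → ≈⇒≈ₙ (inverseˡ x)) , (λ x → ≈⇒≈ₙ (inverseʳ x))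
      ; ⁻¹-cong = ≈ₙ-⁻¹-cong
      }
    }
    where
    open Group G using () renaming (refl to ≈-refl; sym to ≈-sym)
    open GroupProperties G
      using (⁻¹-involutive; ⁻¹-anti-homo-∙; \\-leftDividesʳ)
    open import Relation.Binary.Reasoning.Setoid setoid

    _≈ₙ_ : Rel Carrier 0ℓ
    x ≈ₙ y = NormalClosure P (x ∙ y ⁻¹)

    ≈⇒≈ₙ : ∀ {x y} → x ≈ y → x ≈ₙ y
    ≈⇒≈ₙ {x} {y} x≈y =
      resp (≈-sym (begin
        x ∙ y ⁻¹  ≈⟨ ∙-congʳ x≈y ⟩
        y ∙ y ⁻¹  ≈⟨ inverseʳ y ⟩
        ε         ∎)) unit

    flip-div : ∀ x y → (x ∙ y ⁻¹) ⁻¹ ≈ y ∙ x ⁻¹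
    flip-div x y = begin
      (x ∙ y ⁻¹) ⁻¹    ≈⟨ ⁻¹-anti-homo-∙ x (y ⁻¹) ⟩
      y ⁻¹ ⁻¹ ∙ x ⁻¹   ≈⟨ ∙-congʳ (⁻¹-involutive y) ⟩
      y ∙ x ⁻¹         ∎

    ≈ₙ-sym : ∀ {x y} → x ≈ₙ y → y ≈ₙ x
    ≈ₙ-sym {x} {y} p = resp (flip-div x y) (inv p)

    ≈ₙ-trans : ∀ {x y z} → x ≈ₙ y → y ≈ₙ z → x ≈ₙ z
    ≈ₙ-trans {x} {y} {z} p q = resp (begin
      (x ∙ y ⁻¹) ∙ (y ∙ z ⁻¹)  ≈⟨ assoc x (y ⁻¹) (y ∙ z ⁻¹) ⟩
      x ∙ (y ⁻¹ ∙ (y ∙ z ⁻¹))  ≈⟨ ∙-congˡ (\\-leftDividesʳ y (z ⁻¹)) ⟩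
      x ∙ z ⁻¹                 ∎) (mul p q)

    ≈ₙ-∙-cong : ∀ {x y u v} → x ≈ₙ y → u ≈ₙ v → (x ∙ u) ≈ₙ (y ∙ v)
    ≈ₙ-∙-cong {x} {y} {u} {v} p q = resp (begin
      (x ∙ (u ∙ v ⁻¹) ∙ x ⁻¹) ∙ (x ∙ y ⁻¹)
        ≈⟨ assoc _ (x ⁻¹) (x ∙ y ⁻¹) ⟩
      (x ∙ (u ∙ v ⁻¹)) ∙ (x ⁻¹ ∙ (x ∙ y ⁻¹))
        ≈⟨ ∙-cong (≈-sym (assoc x u (v ⁻¹))) (\\-leftDividesʳ x (y ⁻¹)) ⟩
      ((x ∙ u) ∙ v ⁻¹) ∙ y ⁻¹
        ≈⟨ assoc (x ∙ u) (v ⁻¹) (y ⁻¹) ⟩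
      (x ∙ u) ∙ (v ⁻¹ ∙ y ⁻¹)
        ≈⟨ ∙-congˡ (⁻¹-anti-homo-∙ y v) ⟨
      (x ∙ u) ∙ (y ∙ v) ⁻¹
        ∎) (mul (conj x q) p)

    ≈ₙ-⁻¹-cong : ∀ {x y} → x ≈ₙ y → (x ⁻¹) ≈ₙ (y ⁻¹)
    ≈ₙ-⁻¹-cong {x} {y} p = resp (begin
      x ⁻¹ ∙ (y ∙ x ⁻¹) ∙ x ⁻¹ ⁻¹    ≈⟨ assoc (x ⁻¹) (y ∙ x ⁻¹) (x ⁻¹ ⁻¹) ⟩
      x ⁻¹ ∙ ((y ∙ x ⁻¹) ∙ x ⁻¹ ⁻¹)  ≈⟨ ∙-congˡ (assoc y (x ⁻¹) (x ⁻¹ ⁻¹)) ⟩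
      x ⁻¹ ∙ (y ∙ (x ⁻¹ ∙ x ⁻¹ ⁻¹))  ≈⟨ ∙-congˡ (∙-congˡ (inverseʳ (x ⁻¹))) ⟩
      x ⁻¹ ∙ (y ∙ ε)                 ≈⟨ ∙-congˡ (identityʳ y) ⟩
      x ⁻¹ ∙ y                       ≈⟨ ∙-congˡ (⁻¹-involutive y) ⟨
      x ⁻¹ ∙ y ⁻¹ ⁻¹                 ∎) (conj (x ⁻¹) (≈ₙ-sym p))

_≅_ : Rel (Group 0ℓ 0ℓ) 0ℓ
G ≅ H = ∃ λ (f : Carrier G → Carrier H) →
  IsGroupIsomorphism (rawGroup G) (rawGroup H) f
  where open Group

Relator : (S : Alphabet) → System S → Pred (Word (Letter S)) 0ℓ
Relator S E w = ∃[ u ] ∃[ v ] (u , v) ∈ E × w ≡ inverse v ++ u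

Γ : (S : Alphabet) → System S → Group 0ℓ 0ℓ
Γ S E = quotient (freeGroup {Letter S}) (Relator S E)

------------------------------------------------------------------------
-- S-graphs

-- Exactly one incoming and one outgoing edge with each label at every
-- vertex: the s-labelled edges form a permutation of the vertices.
record SGraph (S : Alphabet) (n : ℕ) : Set where
  field
    edges : Letter S → Permutation′ n

open SGraph public

module _ {S : Alphabet} {n : ℕ} where

  step : SGraph S n → Letter S ± → Fin n → Fin n
  step G (s ⁺) x = edges G s ⟨$⟩ʳ x
  step G (s ⁻) x = edges G s ⟨$⟩ˡ x

  act : SGraph S n → Word (Letter S) → Fin n → Fin n
  act G w x = foldr (step G) x w

  GSol : System S → Pred (SGraph S n) 0ℓ
  GSol E G = ∀ {u v} → (u , v) ∈ E → ∀ x → act G u x ≡ act G v x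

  disagreements : SGraph S n → SGraph S n → Letter S → ℕ
  disagreements G G′ s =
    length (filter (λ x → ¬? (edges G s ⟨$⟩ʳ x ≟ edges G′ s ⟨$⟩ʳ x)) (allFin n))

  dᴴ : .{{_ : NonZero n}} → SGraph S n → SGraph S n → ℚ
  dᴴ G G′ = sum {size S} λ i →
    + disagreements G G′ (Inverse.from (letters S) i) / n

  GSol≥ : .{{_ : NonZero n}} → ℚ → System S → Pred (SGraph S n) 0ℓ
  GSol≥ ε E G = ∀ G′ → GSol E G′ → ε ≤ dᴴ G G′

------------------------------------------------------------------------
-- Testers

data Verdict : Set where
  accept reject : Verdict

-- Randomised adaptive algorithms, for a fixed number n of vertices, that
-- make at most q queries on every run.  Randomness is a uniform choice
-- among m alternatives, which yields every finitely supported distribution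
-- with rational weights.  Real weights would not give more (ε , q)-testers:
-- for fixed n and q there are finitely many deterministic algorithms up to
-- behaviour, and being a tester is a system of linear inequalities with
-- rational coefficients on the weights given to them, so it is solvable over
-- the reals only if it is solvable over the rationals.
data Algorithm (S : Alphabet) (n : ℕ) : ℕ → Set where
  output : ∀ {q} → Verdict → Algorithm S n q
  random : ∀ {q} (m : ℕ) .{{_ : NonZero m}} →
           (Fin m → Algorithm S n q) → Algorithm S n q
  query  : ∀ {q} → Letter S ± → Fin n →
           (Fin n → Algorithm S n q) → Algorithm S n (suc q)

-- The probability that the algorithm, run on G, outputs the given verdict.
Pr : ∀ {S n q} → Verdict → Algorithm S n q → SGraph S n → ℚ
Pr accept (output accept) G = 1ℚ
Pr accept (output reject) G = 0ℚ
Pr reject (output accept) G = 0ℚ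
Pr reject (output reject) G = 1ℚ
Pr v (random m A)  G = (+ 1 / m) * sum (λ i → Pr v (A i) G)
Pr v (query s x A) G = Pr v (A (step G s x)) G

record Tester (S : Alphabet) (E : System S) (ε : ℚ) (q : ℕ) : Set where
  field
    algorithm : ∀ n .{{_ : NonZero n}} → Algorithm S n q
    accepts   : ∀ n .{{_ : NonZero n}} (G : SGraph S n) → GSol E G →
                + 99 / 100 ≤ Pr accept (algorithm n) G
    rejects   : ∀ n .{{_ : NonZero n}} (G : SGraph S n) → GSol≥ ε E G →
                + 99 / 100 ≤ Pr reject (algorithm n) G

-- As dᴴ takes rational values and an (ε , q)-tester is an (ε′ , q)-tester
-- for every ε′ ≥ ε, it suffices to quantify over rational ε.
Testable : (S : Alphabet) → System S → Set
Testable S E = ∀ ε → 0ℚ < ε → ∃[ q ] Tester S E ε q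

{-# OPTIONS --safe #-}

-- An isomorphism f : Γ(E₁) ≅ Γ(E₂) with inverse g assigns to every s ∈ S a word
-- σ s over T representing f s, and to every t ∈ T a word τ t over S representing
-- g t.  Letting s act on a T-graph H as the word σ s does gives an S-graph σ*H,
-- and likewise there is τ*G for an S-graph G; both operations preserve solutions.
-- If E₁ is testable, test H for E₂ as follows.  At k random vertices x check that
-- each t ∈ T and the image under σ of τ t send x to the same vertex, which always
-- holds for solutions; then run a tester for E₁ on σ*H.  Let β be the fraction of
-- vertices failing the check.  For G solving E₁, the graph τ*G solves E₂ and
--   d(H , τ*G) ≤ |T| (β + L d(σ*H , G))    where L = max |τ t|.
-- So if H is ε-far from solving E₂, then for small η either β ≥ η, and the checks
-- fail with high probability, or σ*H is η-far from solving E₁.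

module Submission where

open import Defs
open import Algebra.Bundles using (Group; CommutativeRing)
import Algebra.Definitions.RawSemiring as RawSemiringDefinitions
open import Algebra.Morphism.Structures
  using (IsGroupHomomorphism; IsGroupIsomorphism)
import Algebra.Properties.Group as GroupProperties
import Algebra.Properties.Semiring.Mult as SemiringMult
import Algebra.Properties.Semiring.Sum as SemiringSum
open import Data.Bool.Base using (Bool; true; false; not; _∧_; if_then_else_)
open import Data.Fin.Base using (Fin; zero; suc)
open import Data.Fin.Permutation
  using (Permutation′; permutation; inverseˡ; inverseʳ; _⟨$⟩ʳ_)
open import Data.Fin.Properties using (_≟_)
open import Data.Integer.Base as ℤ using (+_)
import Data.Integer.Solver as ℤ-Solver
open import Data.List.Base
  using (List; []; _∷_; _++_; allFin; concatMap; filter; length; map; reverse; tabulate)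
open import Data.List.Extrema.Nat using (max; xs≤max)
open import Data.List.Membership.Propositional using (_∈_)
open import Data.List.Membership.Propositional.Properties
  using (∈-map⁺; ∈-map⁻; ∈-allFin)
open import Data.List.Properties using (foldr-++; length-map; length-reverse)
open import Data.List.Relation.Unary.All as All using (All; all?)
open import Data.Nat.Base as ℕ using (ℕ; zero; suc; NonZero)
open import Data.Nat.GeneralisedArithmetic using (fold)
import Data.Nat.Properties as ℕ
open import Data.Product.Base using (_×_; ∃-syntax; _,_; proj₁; proj₂)
open import Data.Rational.Base hiding (NonZero)
open import Data.Rational.Properties hiding (_≟_)
open import Data.Rational.Solver using (module +-*-Solver)
import Data.Rational.Unnormalised.Base as ℚᵘ
import Data.Rational.Unnormalised.Properties as ℚᵘ
open import Data.Vec.Functional using (Vector; replicate)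
open import Function.Base using (_∘_; id)
open import Function.Bundles using (_⇔_; mk⇔; Inverse)
open import Relation.Binary.Bundles using (Setoid)
open import Relation.Binary.Construct.Closure.Equivalence as Eq using ()
open import Relation.Binary.PropositionalEquality
  using (_≡_; _≗_; _→-setoid_; refl; sym; trans; cong; cong₂; subst; module ≡-Reasoning)
import Relation.Binary.Reasoning.Setoid as SetoidReasoning
open import Relation.Nullary using (Dec; yes; no; does; contradiction)
open import Relation.Nullary.Decidable using (¬?; dec-true)
open import Relation.Unary using (Pred; Decidable)

open Group using (rawGroup)
open RawSemiringDefinitions +-*-rawSemiring using (_^_; sum) renaming (_×_ to _·_)
open SemiringMult (CommutativeRing.semiring +-*-commutativeRing)
  using (×-comm-*; ×-assoc-*; ×-assocˡ)
open SemiringSum (CommutativeRing.semiring +-*-commutativeRing)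
  using (sum-cong-≗; sum-permute; sum-replicate; ∑-distrib-+; *-distribʳ-sum)

-- Words and their action on graphs

-- Surjectivity of `f` supplies a section `g`. Every law required of `g` is checked after applying
-- `f`, whose injectivity carries it back.
≅-sym : ∀ {G H} → G ≅ H → H ≅ G
≅-sym {G} {H} (f , f-iso) = g , record
  { isGroupMonomorphism = record
    { isGroupHomomorphism = record
      { isMonoidHomomorphism = record
        { isMagmaHomomorphism = record
          { isRelHomomorphism = record { cong = g-cong }
          ; homo = λ x y → f.injective (H.trans (f∘g _)
              (H.sym (H.trans (f.∙-homo _ _) (H.∙-cong (f∘g x) (f∘g y)))))
          }
        ; ε-homo = f.injective (H.trans (f∘g _) (H.sym f.ε-homo))
        }
      ; ⁻¹-homo = λ x → f.injective (H.trans (f∘g _)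
          (H.sym (H.trans (f.⁻¹-homo _) (H.⁻¹-cong (f∘g x)))))
      }
    ; injective = λ {x} {y} gx≈gy →
        H.trans (H.sym (f∘g x)) (H.trans (f.⟦⟧-cong gx≈gy) (f∘g y))
    }
  ; surjective = λ x → f x , λ y≈fx → f.injective (H.trans (f∘g _) y≈fx)
  }
  where
  module G = Group G
  module H = Group H
  module f = IsGroupIsomorphism f-iso

  g : H.Carrier → G.Carrier
  g y = proj₁ (f.surjective y)

  f∘g : ∀ y → f (g y) H.≈ y
  f∘g y = proj₂ (f.surjective y) G.refl

  g-cong : ∀ {x y} → x H.≈ y → g x G.≈ g y
  g-cong x≈y = f.injective (H.trans (f∘g _) (H.trans x≈y (H.sym (f∘g _))))

module _ {A B : Set} (σ : A → Word B) where

  image± : A ± → Word B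
  image± (a ⁺) = σ a
  image± (a ⁻) = inverse (σ a)

  image : Word A → Word B
  image = concatMap image±

module _ {S : Alphabet} {n : ℕ} where

  act-++ : (G : SGraph S n) (u v : Word (Letter S)) →
           act G (u ++ v) ≗ act G u ∘ act G v
  act-++ G u v x = foldr-++ (step G) x u v

  step-flip± : (G : SGraph S n) (s : Letter S ±) →
               step G s ∘ step G (flip± s) ≗ id
  step-flip± G (s ⁺) x = inverseʳ (edges G s)
  step-flip± G (s ⁻) x = inverseˡ (edges G s)

  act-⟶ : (G : SGraph S n) {u v : Word (Letter S)} →
          u ⟶ v → act G u ≗ act G v
  act-⟶ G (cancel u s v) x = begin
    act G (u ++ s ∷ flip± s ∷ v) x                     ≡⟨ act-++ G u _ x ⟩
    act G u (step G s (step G (flip± s) (act G v x)))  ≡⟨ cong (act G u) (step-flip± G s _) ⟩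
    act G u (act G v x)                                ≡⟨ act-++ G u v x ⟨
    act G (u ++ v) x                                   ∎
    where open ≡-Reasoning

  act-~ : (G : SGraph S n) {u v : Word (Letter S)} → u ~ v → act G u ≗ act G v
  act-~ G = Eq.gfold (Setoid.isEquivalence (Fin n →-setoid Fin n)) (act G) (act-⟶ G)

  act-inverseˡ : (G : SGraph S n) (w : Word (Letter S)) →
                 act G (inverse w) ∘ act G w ≗ id
  act-inverseˡ G w x = trans (sym (act-++ G (inverse w) w x))
                             (act-~ G (Group.inverseˡ freeGroup w) x)

  act-inverseʳ : (G : SGraph S n) (w : Word (Letter S)) →
                 act G w ∘ act G (inverse w) ≗ id
  act-inverseʳ G w x = trans (sym (act-++ G w (inverse w) x))
                             (act-~ G (Group.inverseʳ freeGroup w) x)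

  actPermutation : SGraph S n → Word (Letter S) → Permutation′ n
  actPermutation G w =
    permutation (act G w) (act G (inverse w)) (act-inverseʳ G w) (act-inverseˡ G w)

  module _ {E : System S} (G : SGraph S n) (solves : GSol E G) where
    open ≡-Reasoning

    -- The words that act trivially on `G` form a normal subgroup, and it contains the relators
    -- because `G` solves `E`.
    act-normalClosure : ∀ {w} → NormalClosure freeGroup (Relator S E) w →
                        ∀ x → act G w x ≡ x
    act-normalClosure (generator (u , v , u=v∈E , refl)) x = begin
      act G (inverse v ++ u) x       ≡⟨ act-++ G (inverse v) u x ⟩
      act G (inverse v) (act G u x)  ≡⟨ cong (act G (inverse v)) (solves u=v∈E x) ⟩
      act G (inverse v) (act G v x)  ≡⟨ act-inverseˡ G v x ⟩
      x                              ∎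
    act-normalClosure (resp g~h p) x =
      trans (sym (act-~ G g~h x)) (act-normalClosure p x)
    act-normalClosure unit x = refl
    act-normalClosure (mul {g} {h} p q) x = begin
      act G (g ++ h) x     ≡⟨ act-++ G g h x ⟩
      act G g (act G h x)  ≡⟨ act-normalClosure p _ ⟩
      act G h x            ≡⟨ act-normalClosure q x ⟩
      x                    ∎
    act-normalClosure (inv {g} p) x = begin
      act G (inverse g) x              ≡⟨ cong (act G (inverse g)) (act-normalClosure p x) ⟨
      act G (inverse g) (act G g x)    ≡⟨ act-inverseˡ G g x ⟩
      x                                ∎
    act-normalClosure (conj h {g} p) x = begin
      act G ((h ++ g) ++ inverse h) x            ≡⟨ act-++ G (h ++ g) (inverse h) x ⟩
      act G (h ++ g) (act G (inverse h) x)       ≡⟨ act-++ G h g _ ⟩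
      act G h (act G g (act G (inverse h) x))    ≡⟨ cong (act G h) (act-normalClosure p _) ⟩
      act G h (act G (inverse h) x)              ≡⟨ act-inverseʳ G h x ⟩
      x                                          ∎

    -- Thus a solution of `E` is an action of `Γ S E`. Inserting `inverse v` after `v` exposes the
    -- word `u ++ inverse v`, which lies in the normal closure.
    act-Γ : ∀ {u v} → Group._≈_ (Γ S E) u v → act G u ≗ act G v
    act-Γ {u} {v} u≈v x = begin
      act G u x                                ≡⟨ cong (act G u) (act-inverseˡ G v x) ⟨
      act G u (act G (inverse v) (act G v x))  ≡⟨ act-++ G u (inverse v) _ ⟨
      act G (u ++ inverse v) (act G v x)       ≡⟨ act-normalClosure u≈v _ ⟩
      act G v x                                ∎

-- The relator is `inverse v ++ u`, whereas equality in the quotient asks for `u ++ inverse v`.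
-- Conjugation by `v` turns one into the other.
relation-Γ : ∀ {S} (E : System S) {u v} → (u , v) ∈ E → Group._≈_ (Γ S E) u v
relation-Γ {S} E {u} {v} u=v∈E =
  resp (F.∙-congʳ (\\-leftDividesˡ v u))
       (conj v (generator (u , v , u=v∈E , refl)))
  where
  module F = Group (freeGroup {Letter S})
  open GroupProperties freeGroup using (\\-leftDividesˡ)

-- Pulling graphs back along substitutions

module _ {S T : Alphabet} (σ : Letter S → Word (Letter T)) {n : ℕ} where

  pull : SGraph T n → SGraph S n
  pull H .edges s = actPermutation H (σ s)

  -- Both cases compute, since `actPermutation` uses the inverse word for the inverse permutation.
  step-pull : ∀ H s → step (pull H) s ≗ act H (image± σ s)
  step-pull H (s ⁺) x = refl
  step-pull H (s ⁻) x = refl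

  act-pull : ∀ H w → act (pull H) w ≗ act H (image σ w)
  act-pull H []      x = refl
  act-pull H (s ∷ w) x = begin
    step (pull H) s (act (pull H) w x)         ≡⟨ step-pull H s _ ⟩
    act H (image± σ s) (act (pull H) w x)      ≡⟨ cong (act H (image± σ s)) (act-pull H w x) ⟩
    act H (image± σ s) (act H (image σ w) x)   ≡⟨ act-++ H (image± σ s) (image σ w) x ⟨
    act H (image σ (s ∷ w)) x                  ∎
    where open ≡-Reasoning

module _ {S T : Alphabet} {E₁ : System S} {E₂ : System T}
         {f : Word (Letter S) → Word (Letter T)}
         (f-hom : IsGroupHomomorphism (rawGroup (Γ S E₁)) (rawGroup (Γ T E₂)) f)
  where
  private
    module Γ₁ = Group (Γ S E₁)
    module Γ₂ = Group (Γ T E₂)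
    module f = IsGroupHomomorphism f-hom

  -- The substitution that lifts `f` to the free groups. The map `f` itself respects products only
  -- modulo `E₂`, so only its values on letters are kept.
  onLetters : Letter S → Word (Letter T)
  onLetters s = f (s ⁺ ∷ [])

  open SetoidReasoning Γ₂.setoid

  hom-image± : ∀ s → f (s ∷ []) Γ₂.≈ image± onLetters s
  hom-image± (s ⁺) = Γ₂.refl {f (s ⁺ ∷ [])}
  hom-image± (s ⁻) = f.⁻¹-homo (s ⁺ ∷ [])

  hom-image : ∀ w → f w Γ₂.≈ image onLetters w
  hom-image []      = f.ε-homo
  hom-image (s ∷ w) = begin
    f (s ∷ w)
      ≈⟨ f.homo (s ∷ []) w ⟩
    f (s ∷ []) ++ f w
      ≈⟨ Γ₂.∙-cong {f (s ∷ [])} {image± onLetters s} {f w} {image onLetters w}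
           (hom-image± s) (hom-image w) ⟩
    image onLetters (s ∷ w)
      ∎

  -- A relation of `E₁` holds in `Γ S E₁`, so `f` maps its sides to equal elements of `Γ T E₂`.
  -- Their substituted forms then act alike on a solution of `E₂`.
  pull-GSol : ∀ {n} {H : SGraph T n} → GSol E₂ H → GSol E₁ (pull {S} onLetters H)
  pull-GSol {H = H} solves {u} {v} u=v∈E₁ x =
    trans (act-pull onLetters H u x)
      (trans (act-Γ H solves {image onLetters u} {image onLetters v} images≈ x)
             (sym (act-pull onLetters H v x)))
    where
    images≈ : image onLetters u Γ₂.≈ image onLetters v
    images≈ = begin
      image onLetters u  ≈⟨ hom-image u ⟨
      f u                ≈⟨ f.⟦⟧-cong {u} {v} (relation-Γ {S} E₁ u=v∈E₁) ⟩
      f v                ≈⟨ hom-image v ⟩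
      image onLetters v  ∎

-- Rational averages and powers

0≤1 : 0ℚ ≤ 1ℚ
0≤1 = *≤* (ℤ.+≤+ ℕ.z≤n)

p≤p+q : ∀ p {q} → 0ℚ ≤ q → p ≤ p + q
p≤p+q p 0≤q = ≤-trans (≤-reflexive (sym (+-identityʳ p))) (+-monoʳ-≤ p 0≤q)

q≤p+q : ∀ {p} q → 0ℚ ≤ p → q ≤ p + q
q≤p+q q 0≤p = ≤-trans (≤-reflexive (sym (+-identityˡ q))) (+-monoˡ-≤ q 0≤p)

*-monoˡ : ∀ {p q r} → 0ℚ ≤ r → p ≤ q → r * p ≤ r * q
*-monoˡ {r = r} 0≤r = *-monoˡ-≤-nonNeg r {{nonNegative 0≤r}}

*-monoʳ : ∀ {p q r} → 0ℚ ≤ r → p ≤ q → p * r ≤ q * r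
*-monoʳ {r = r} 0≤r = *-monoʳ-≤-nonNeg r {{nonNegative 0≤r}}

*-nonNeg : ∀ {p q} → 0ℚ ≤ p → 0ℚ ≤ q → 0ℚ ≤ p * q
*-nonNeg {p} 0≤p 0≤q = ≤-trans (≤-reflexive (sym (*-zeroʳ p))) (*-monoˡ 0≤p 0≤q)

·-monoʳ : ∀ n {p q} → p ≤ q → n · p ≤ n · q
·-monoʳ zero    p≤q = ≤-refl
·-monoʳ (suc n) p≤q = +-mono-≤ p≤q (·-monoʳ n p≤q)

·-nonNeg : ∀ n {p} → 0ℚ ≤ p → 0ℚ ≤ n · p
·-nonNeg zero    0≤p = ≤-refl
·-nonNeg (suc n) 0≤p = +-mono-≤ 0≤p (·-nonNeg n 0≤p)

·-monoˡ : ∀ {m n p} → 0ℚ ≤ p → m ℕ.≤ n → m · p ≤ n · p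
·-monoˡ {n = n} 0≤p ℕ.z≤n       = ·-nonNeg n 0≤p
·-monoˡ {p = p} 0≤p (ℕ.s≤s m≤n) = +-monoʳ-≤ p (·-monoˡ 0≤p m≤n)

-- Fractions in `ℚ` are reduced to lowest terms. On unnormalised fractions the claim becomes a
-- polynomial identity over the integers.
suc/n : ∀ m n .{{_ : NonZero n}} → + suc m / n ≡ + 1 / n + + m / n
suc/n m n@(suc d) = toℚᵘ-injective (begin
  toℚᵘ (+ suc m / n)
    ≈⟨ toℚᵘ-fromℚᵘ (ℚᵘ.mkℚᵘ (+ suc m) d) ⟩
  ℚᵘ.mkℚᵘ (+ suc m) d
    ≈⟨ ℚᵘ.*≡* (solve 2 (λ a b → (con (+ 1) :+ a) :* (b :* b) :=
                                (con (+ 1) :* b :+ a :* b) :* b) refl (+ m) (+ n)) ⟩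
  ℚᵘ.mkℚᵘ (+ 1) d ℚᵘ.+ ℚᵘ.mkℚᵘ (+ m) d
    ≈⟨ ℚᵘ.+-cong (toℚᵘ-fromℚᵘ (ℚᵘ.mkℚᵘ (+ 1) d)) (toℚᵘ-fromℚᵘ (ℚᵘ.mkℚᵘ (+ m) d)) ⟨
  toℚᵘ (+ 1 / n) ℚᵘ.+ toℚᵘ (+ m / n)
    ≈⟨ toℚᵘ-homo-+ (+ 1 / n) (+ m / n) ⟨
  toℚᵘ (+ 1 / n + + m / n)               ∎)
  where
  open ℤ-Solver.+-*-Solver
  open SetoidReasoning ℚᵘ.≃-setoid

m/n≡m·1/n : ∀ m n .{{_ : NonZero n}} → + m / n ≡ m · (+ 1 / n)
m/n≡m·1/n zero    n = 0/n≡0 n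
m/n≡m·1/n (suc m) n = trans (suc/n m n) (cong (_+_ (+ 1 / n)) (m/n≡m·1/n m n))

n/n≡1 : ∀ n .{{_ : NonZero n}} → + n / n ≡ 1ℚ
n/n≡1 n@(suc d) = fromℚᵘ-cong {ℚᵘ.mkℚᵘ (+ n) d} {ℚᵘ.mkℚᵘ (+ 1) 0}
  (ℚᵘ.*≡* (solve 1 (λ a → a :* con (+ 1) := con (+ 1) :* a) refl (+ n)))
  where open ℤ-Solver.+-*-Solver

n·1/n≡1 : ∀ n .{{_ : NonZero n}} → n · (+ 1 / n) ≡ 1ℚ
n·1/n≡1 n = trans (sym (m/n≡m·1/n n n)) (n/n≡1 n)

0≤1/n : ∀ n .{{_ : NonZero n}} → 0ℚ ≤ + 1 / n
0≤1/n n = nonNegative⁻¹ (+ 1 / n) {{normalize-nonNeg 1 n}}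

sum-mono : ∀ {n} {f g : Vector ℚ n} → (∀ i → f i ≤ g i) → sum f ≤ sum g
sum-mono {zero}  f≤g = ≤-refl
sum-mono {suc n} f≤g = +-mono-≤ (f≤g zero) (sum-mono (f≤g ∘ suc))

sum-nonNeg : ∀ {n} {f : Vector ℚ n} → (∀ i → 0ℚ ≤ f i) → 0ℚ ≤ sum f
sum-nonNeg {zero}  0≤f = ≤-refl
sum-nonNeg {suc n} 0≤f = +-mono-≤ (0≤f zero) (sum-nonNeg (0≤f ∘ suc))

term≤sum : ∀ {n} {f : Vector ℚ n} → (∀ i → 0ℚ ≤ f i) → ∀ i → f i ≤ sum f
term≤sum {f = f} 0≤f zero    = p≤p+q (f zero) (sum-nonNeg (0≤f ∘ suc))
term≤sum {f = f} 0≤f (suc i) =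
  ≤-trans (term≤sum (0≤f ∘ suc) i) (q≤p+q (sum (f ∘ suc)) (0≤f zero))

module _ {n : ℕ} .{{_ : NonZero n}} where

  -- Expectation under a uniform choice. `Pr` on `random` unfolds to this expression, so the laws
  -- below apply directly to probabilities.
  mean : Vector ℚ n → ℚ
  mean f = (+ 1 / n) * sum f

  mean-cong : ∀ {f g} → f ≗ g → mean f ≡ mean g
  mean-cong f≗g = cong ((+ 1 / n) *_) (sum-cong-≗ f≗g)

  mean-mono : ∀ {f g} → (∀ x → f x ≤ g x) → mean f ≤ mean g
  mean-mono f≤g = *-monoˡ (0≤1/n n) (sum-mono f≤g)

  mean-+ : ∀ f g → mean (λ x → f x + g x) ≡ mean f + mean g
  mean-+ f g = trans (cong ((+ 1 / n) *_) (∑-distrib-+ f g))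
                     (*-distribˡ-+ (+ 1 / n) (sum f) (sum g))

  mean-*ʳ : ∀ f c → mean (λ x → f x * c) ≡ mean f * c
  mean-*ʳ f c = trans (cong ((+ 1 / n) *_) (sym (*-distribʳ-sum c f)))
                      (sym (*-assoc (+ 1 / n) (sum f) c))

  mean-const : ∀ c → mean (λ _ → c) ≡ c
  mean-const c = begin
    (+ 1 / n) * sum (replicate n c)  ≡⟨ cong ((+ 1 / n) *_) (sum-replicate n) ⟩
    (+ 1 / n) * (n · c)              ≡⟨ ×-comm-* n (+ 1 / n) c ⟩
    n · ((+ 1 / n) * c)              ≡⟨ ×-assoc-* n (+ 1 / n) c ⟨
    (n · (+ 1 / n)) * c              ≡⟨ cong (_* c) (n·1/n≡1 n) ⟩
    1ℚ * c                           ≡⟨ *-identityˡ c ⟩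
    c                                ∎
    where open ≡-Reasoning

  mean-permute : ∀ f (π : Permutation′ n) → mean (f ∘ (π ⟨$⟩ʳ_)) ≡ mean f
  mean-permute f π = cong ((+ 1 / n) *_) (sym (sum-permute f π))

  mean-nonNeg : ∀ {f} → (∀ x → 0ℚ ≤ f x) → 0ℚ ≤ mean f
  mean-nonNeg 0≤f = *-nonNeg (0≤1/n n) (sum-nonNeg 0≤f)

-- Indicators and counting

indicator : Bool → ℚ
indicator true  = 1ℚ
indicator false = 0ℚ

𝟙 : ∀ {p} {P : Set p} → Dec P → ℚ
𝟙 P? = indicator (does P?)

indicator-∧ : ∀ b c → indicator (b ∧ c) ≡ indicator b * indicator c
indicator-∧ true  c = sym (*-identityˡ _)
indicator-∧ false c = sym (*-zeroˡ (indicator c))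

indicator-not : ∀ b → indicator b + indicator (not b) ≡ 1ℚ
indicator-not true  = refl
indicator-not false = refl

indicator-nonNeg : ∀ b → 0ℚ ≤ indicator b
indicator-nonNeg true  = 0≤1
indicator-nonNeg false = ≤-refl

𝟙-true : ∀ {p} {P : Set p} (P? : Dec P) → P → 𝟙 P? ≡ 1ℚ
𝟙-true P? p = cong indicator (dec-true P? p)

𝟙-¬-antimono : ∀ {p q} {P : Set p} {Q : Set q} (P? : Dec P) (Q? : Dec Q) →
               (Q → P) → 𝟙 (¬? P?) ≤ 𝟙 (¬? Q?)
𝟙-¬-antimono (yes _) Q?      Q→P = indicator-nonNeg (not (does Q?))
𝟙-¬-antimono (no ¬p) (yes q) Q→P = contradiction (Q→P q) ¬p
𝟙-¬-antimono (no _)  (no _)  Q→P = ≤-refl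

-- The pointwise union bound: `R` can fail only where `P` or `Q` fails.
𝟙-¬-∩ : ∀ {p q r} {P : Set p} {Q : Set q} {R : Set r}
        (P? : Dec P) (Q? : Dec Q) (R? : Dec R) → (P → Q → R) →
        𝟙 (¬? R?) ≤ 𝟙 (¬? P?) + 𝟙 (¬? Q?)
𝟙-¬-∩ P?      Q?      (yes _) P∩Q⊆R = +-mono-≤ (indicator-nonNeg (not (does P?)))
                                               (indicator-nonNeg (not (does Q?)))
𝟙-¬-∩ (yes p) (yes q) (no ¬r) P∩Q⊆R = contradiction (P∩Q⊆R p q) ¬r
𝟙-¬-∩ (yes _) (no _)  (no _)  P∩Q⊆R = ≤-refl
𝟙-¬-∩ (no _)  Q?      (no _)  P∩Q⊆R = p≤p+q 1ℚ (indicator-nonNeg (not (does Q?)))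

-- This turns the counts in `dᴴ` into means. The denominator `n` is kept apart from the length `m`
-- so that it stays fixed in the induction, and `tabulate f` generalises `allFin` so that tails keep
-- the same form.
count/n : ∀ {A : Set} {p} {P : Pred A p} (P? : Decidable P) {m} (f : Fin m → A)
          n .{{_ : NonZero n}} →
          + length (filter P? (tabulate f)) / n ≡ (+ 1 / n) * sum (𝟙 ∘ P? ∘ f)
count/n P? {zero}  f n = trans (0/n≡0 n) (sym (*-zeroʳ (+ 1 / n)))
count/n P? {suc m} f n with does (P? (f zero)) | count/n P? (f ∘ suc) n
... | false | ih = trans ih (cong ((+ 1 / n) *_) (sym (+-identityˡ _)))
... | true  | ih = begin
  + suc count / n
    ≡⟨ suc/n count n ⟩
  + 1 / n + + count / n
    ≡⟨ cong₂ _+_ (sym (*-identityʳ (+ 1 / n))) ih ⟩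
  (+ 1 / n) * 1ℚ + (+ 1 / n) * sum (𝟙 ∘ P? ∘ f ∘ suc)
    ≡⟨ *-distribˡ-+ (+ 1 / n) 1ℚ _ ⟨
  (+ 1 / n) * (1ℚ + sum (𝟙 ∘ P? ∘ f ∘ suc))  ∎
  where
  open ≡-Reasoning
  count : ℕ
  count = length (filter P? (tabulate (f ∘ suc)))

-- Decay of powers and choice of constants

^-nonNeg : ∀ {ρ} → 0ℚ ≤ ρ → ∀ k → 0ℚ ≤ ρ ^ k
^-nonNeg 0≤ρ zero    = 0≤1
^-nonNeg 0≤ρ (suc k) = *-nonNeg 0≤ρ (^-nonNeg 0≤ρ k)

^-≤1 : ∀ {ρ} → 0ℚ ≤ ρ → ρ ≤ 1ℚ → ∀ k → ρ ^ k ≤ 1ℚ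
^-≤1 0≤ρ ρ≤1 zero = ≤-refl
^-≤1 {ρ} 0≤ρ ρ≤1 (suc k) =
  ≤-trans (*-monoˡ 0≤ρ (^-≤1 0≤ρ ρ≤1 k)) (≤-trans (≤-reflexive (*-identityʳ ρ)) ρ≤1)

-- A division-free form of Bernoulli's inequality. With `a = 1ℚ + k · η`, the induction step needs
-- `ρ * (a + η) ≤ a`; since `ρ ≤ 1 ≤ a`, the left side is at most `(ρ + η) * a`.
bernoulli : ∀ {ρ η} → 0ℚ ≤ ρ → 0ℚ ≤ η → ρ + η ≤ 1ℚ →
            ∀ k → ρ ^ k * (1ℚ + k · η) ≤ 1ℚ
bernoulli 0≤ρ 0≤η ρ+η≤1 zero = ≤-refl
bernoulli {ρ} {η} 0≤ρ 0≤η ρ+η≤1 (suc k) = begin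
  (ρ * ρ ^ k) * (1ℚ + (η + k · η))
    ≡⟨ solve 4 (λ a b c d → (a :* b) :* (con 1ℚ :+ (c :+ d)) :=
                            b :* (a :* (con 1ℚ :+ d) :+ a :* c))
         refl ρ (ρ ^ k) η (k · η) ⟩
  ρ ^ k * (ρ * a + ρ * η)  ≤⟨ *-monoˡ (^-nonNeg 0≤ρ k) (+-monoʳ-≤ (ρ * a) ρη≤ηa) ⟩
  ρ ^ k * (ρ * a + η * a)  ≡⟨ cong (ρ ^ k *_) (*-distribʳ-+ a ρ η) ⟨
  ρ ^ k * ((ρ + η) * a)    ≤⟨ *-monoˡ (^-nonNeg 0≤ρ k) (*-monoʳ (≤-trans 0≤1 1≤a) ρ+η≤1) ⟩
  ρ ^ k * (1ℚ * a)         ≡⟨ cong (ρ ^ k *_) (*-identityˡ a) ⟩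
  ρ ^ k * a                ≤⟨ bernoulli 0≤ρ 0≤η ρ+η≤1 k ⟩
  1ℚ                       ∎
  where
  open ≤-Reasoning
  open +-*-Solver

  a : ℚ
  a = 1ℚ + k · η

  1≤a : 1ℚ ≤ a
  1≤a = p≤p+q 1ℚ (·-nonNeg k 0≤η)

  ρ≤a : ρ ≤ a
  ρ≤a = ≤-trans (p≤p+q ρ 0≤η) (≤-trans ρ+η≤1 1≤a)

  ρη≤ηa : ρ * η ≤ η * a
  ρη≤ηa = ≤-trans (*-monoʳ 0≤η ρ≤a) (≤-reflexive (*-comm a η))

-- A positive fraction with denominator `d` is at least `1 / d`, so `d` copies of it reach 1.
archimedean : ∀ {η} → 0ℚ < η → ∀ m → ∃[ k ] m · 1ℚ ≤ k · η
archimedean {η@(mkℚ (+ suc a) d-1 _)} 0<η m = m ℕ.* d , (begin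
  m · 1ℚ               ≡⟨ cong (m ·_) (n·1/n≡1 d) ⟨
  m · (d · (+ 1 / d))  ≤⟨ ·-monoʳ m (·-monoʳ d 1/d≤η) ⟩
  m · (d · η)          ≡⟨ ×-assocˡ η m d ⟩
  (m ℕ.* d) · η        ∎)
  where
  open ≤-Reasoning
  d = suc d-1
  1/d≤η : + 1 / d ≤ η
  1/d≤η = begin
    + 1 / d            ≤⟨ p≤p+q (+ 1 / d) (nonNegative⁻¹ (+ a / d) {{normalize-nonNeg a d}}) ⟩
    + 1 / d + + a / d  ≡⟨ suc/n a d ⟨
    + suc a / d        ≡⟨ ↥p/↧p≡p η ⟩
    η                  ∎
archimedean {mkℚ (+ 0) _ _}        (*<* (ℤ.+<+ ()))
archimedean {mkℚ ℤ.-[1+ _ ] _ _}   (*<* ())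

-- One `k` serves all `ρ` at once, so the number of spot checks can be fixed before the graph is
-- known. Once `k · η` reaches 99, the factor `1 + k · η` in `bernoulli` is at least 100.
^-vanishing : ∀ {η} → 0ℚ < η →
              ∃[ k ] ∀ {ρ} → 0ℚ ≤ ρ → ρ + η ≤ 1ℚ → ρ ^ k ≤ + 1 / 100
^-vanishing {η} 0<η with archimedean 0<η 99
... | k , 99≤kη = k , λ {ρ} 0≤ρ ρ+η≤1 → begin
  ρ ^ k
    ≡⟨ solve 1 (λ a → a := (a :* con (1ℚ + 99 · 1ℚ)) :* con (+ 1 / 100)) refl (ρ ^ k) ⟩
  ρ ^ k * (1ℚ + 99 · 1ℚ) * (+ 1 / 100)
    ≤⟨ *-monoʳ (0≤1/n 100) (*-monoˡ (^-nonNeg 0≤ρ k) (+-monoʳ-≤ 1ℚ 99≤kη)) ⟩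
  ρ ^ k * (1ℚ + k · η) * (+ 1 / 100)
    ≤⟨ *-monoʳ (0≤1/n 100) (bernoulli 0≤ρ (<⇒≤ 0<η) ρ+η≤1 k) ⟩
  1ℚ * (+ 1 / 100)
    ≡⟨⟩
  + 1 / 100
    ∎
  where
  open ≤-Reasoning
  open +-*-Solver

complement : ∀ p q → p + q ≡ 1ℚ → q ≡ 1ℚ - p
complement p q p+q≡1 =
  trans (solve 2 (λ a b → b := (a :+ b) :+ (:- a)) refl p q) (cong (_- p) p+q≡1)
  where open +-*-Solver

-- Converts a bound on the probability of one verdict into a bound on the other.
complement-antimono : ∀ {p q p′ q′} → p + q ≡ 1ℚ → p′ + q′ ≡ 1ℚ → p ≤ p′ → q′ ≤ q
complement-antimono {p} {q} {p′} {q′} p+q≡1 p′+q′≡1 p≤p′ = begin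
  q′       ≡⟨ complement p′ q′ p′+q′≡1 ⟩
  1ℚ - p′  ≤⟨ +-monoʳ-≤ 1ℚ (neg-antimono-≤ p≤p′) ⟩
  1ℚ - p   ≡⟨ complement p q p+q≡1 ⟨
  q        ∎
  where open ≤-Reasoning

-- Dividing `ε` by `suc N` makes the inequality strict and covers `N = 0`.
∃-multiple< : ∀ N {ε} → 0ℚ < ε → ∃[ η ] 0ℚ < η × N · η < ε
∃-multiple< N {ε} 0<ε = η , 0<η , (begin-strict
  N · η                        ≡⟨ +-identityˡ (N · η) ⟨
  0ℚ + N · η                   <⟨ +-monoˡ-< (N · η) 0<η ⟩
  suc N · η                    ≡⟨ ×-comm-* (suc N) ε (+ 1 / suc N) ⟨
  ε * (suc N · (+ 1 / suc N))  ≡⟨ cong (ε *_) (n·1/n≡1 (suc N)) ⟩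
  ε * 1ℚ                       ≡⟨ *-identityʳ ε ⟩
  ε                            ∎)
  where
  open ≤-Reasoning
  η : ℚ
  η = ε * (+ 1 / suc N)
  0<η : 0ℚ < η
  0<η = positive⁻¹ η {{pos*pos⇒pos ε {{positive 0<ε}} (+ 1 / suc N) {{normalize-pos 1 (suc N)}}}}

-- Algorithms

-- Follows the recursion of `check`, so that the query bounds there agree by computation.
checkCost : ∀ S → System S → ℕ → ℕ
checkCost S []            q = q
checkCost S ((u , v) ∷ R) q = length u ℕ.+ (length v ℕ.+ checkCost S R q)

module _ {S : Alphabet} {n : ℕ} where

  weaken : ∀ {p q} → p ℕ.≤ q → Algorithm S n p → Algorithm S n q
  weaken p≤q         (output v)    = output v
  weaken p≤q         (random m A)  = random m (λ i → weaken p≤q (A i))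
  weaken (ℕ.s≤s p≤q) (query s x A) = query s x (λ y → weaken p≤q (A y))

  Pr-weaken : ∀ {p q} (p≤q : p ℕ.≤ q) (A : Algorithm S n p) G →
              Pr accept (weaken p≤q A) G ≡ Pr accept A G
  Pr-weaken p≤q         (output accept) G = refl
  Pr-weaken p≤q         (output reject) G = refl
  Pr-weaken p≤q         (random m A)    G = mean-cong (λ i → Pr-weaken p≤q (A i) G)
  Pr-weaken (ℕ.s≤s p≤q) (query s x A)   G = Pr-weaken p≤q (A (step G s x)) G

  Pr-nonNeg : ∀ {q} (A : Algorithm S n q) G → 0ℚ ≤ Pr accept A G
  Pr-nonNeg (output accept) G = 0≤1
  Pr-nonNeg (output reject) G = ≤-refl
  Pr-nonNeg (random m A)    G = mean-nonNeg (λ i → Pr-nonNeg (A i) G)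
  Pr-nonNeg (query s x A)   G = Pr-nonNeg (A (step G s x)) G

  Pr-≤1 : ∀ {q} (A : Algorithm S n q) G → Pr accept A G ≤ 1ℚ
  Pr-≤1 (output accept) G = ≤-refl
  Pr-≤1 (output reject) G = 0≤1
  Pr-≤1 (random m A)    G = ≤-trans (mean-mono (λ i → Pr-≤1 (A i) G)) (≤-reflexive (mean-const 1ℚ))
  Pr-≤1 (query s x A)   G = Pr-≤1 (A (step G s x)) G

  -- Allows the transformations of algorithms below to be analysed for `accept` alone.
  Pr-total : ∀ {q} (A : Algorithm S n q) G → Pr accept A G + Pr reject A G ≡ 1ℚ
  Pr-total (output accept) G = refl
  Pr-total (output reject) G = refl
  Pr-total (random m A)    G =
    trans (sym (mean-+ (λ i → Pr accept (A i) G) (λ i → Pr reject (A i) G)))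
          (trans (mean-cong (λ i → Pr-total (A i) G)) (mean-const 1ℚ))
  Pr-total (query s x A)   G = Pr-total (A (step G s x)) G

  walk : ∀ {q} (w : Word (Letter S)) → Fin n → (Fin n → Algorithm S n q) →
         Algorithm S n (length w ℕ.+ q)
  walk     []      x A = A x
  -- The rightmost letter acts first, so `s` is queried last; `weaken` only moves the resulting
  -- successor out of the sum.
  walk {q} (s ∷ w) x A =
    weaken (ℕ.≤-reflexive (ℕ.+-suc (length w) q)) (walk w x (λ y → query s y A))

  Pr-walk : ∀ {q} w x (A : Fin n → Algorithm S n q) G →
            Pr accept (walk w x A) G ≡ Pr accept (A (act G w x)) G
  Pr-walk []      x A G = refl
  Pr-walk (s ∷ w) x A G =
    trans (Pr-weaken _ (walk w x (λ y → query s y A)) G)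
          (Pr-walk w x (λ y → query s y A) G)

  SatisfiedAt : SGraph S n → System S → Fin n → Set
  SatisfiedAt G R x = All (λ (u , v) → act G u x ≡ act G v x) R

  satisfiedAt? : ∀ G R x → Dec (SatisfiedAt G R x)
  satisfiedAt? G R x = all? (λ (u , v) → act G u x ≟ act G v x) R

  check : ∀ {q} R → Fin n → Algorithm S n q → Algorithm S n (checkCost S R q)
  check []            x A = A
  check ((u , v) ∷ R) x A = walk u x λ y → walk v x λ z →
    if does (y ≟ z) then check R x A else output reject

  Pr-check : ∀ {q} R x (A : Algorithm S n q) G →
             Pr accept (check R x A) G ≡ 𝟙 (satisfiedAt? G R x) * Pr accept A G
  Pr-check []            x A G = sym (*-identityˡ _)
  Pr-check ((u , v) ∷ R) x A G = begin
    Pr accept (check ((u , v) ∷ R) x A) G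
      ≡⟨ Pr-walk u x _ G ⟩
    Pr accept (walk v x (branch (act G u x))) G
      ≡⟨ Pr-walk v x _ G ⟩
    Pr accept (branch (act G u x) (act G v x)) G
      ≡⟨ Pr-if b ⟩
    indicator b * Pr accept (check R x A) G
      ≡⟨ cong (indicator b *_) (Pr-check R x A G) ⟩
    indicator b * (𝟙 (satisfiedAt? G R x) * Pr accept A G)
      ≡⟨ *-assoc (indicator b) (𝟙 (satisfiedAt? G R x)) (Pr accept A G) ⟨
    indicator b * 𝟙 (satisfiedAt? G R x) * Pr accept A G
      -- On a nonempty list `all?` computes to a conjunction, so the indicators multiply.
      ≡⟨ cong (_* Pr accept A G) (indicator-∧ b (does (satisfiedAt? G R x))) ⟨
    𝟙 (satisfiedAt? G ((u , v) ∷ R) x) * Pr accept A G ∎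
    where
    open ≡-Reasoning

    b : Bool
    b = does (act G u x ≟ act G v x)

    branch : Fin n → Fin n → Algorithm S n _
    branch y z = if does (y ≟ z) then check R x A else output reject

    Pr-if : ∀ b → Pr accept (if b then check R x A else output reject) G ≡
                  indicator b * Pr accept (check R x A) G
    Pr-if true  = sym (*-identityˡ _)
    Pr-if false = sym (*-zeroˡ (Pr accept (check R x A) G))

-- Spot checks at random vertices

module _ {S : Alphabet} {n : ℕ} .{{_ : NonZero n}} where

  satisfaction : SGraph S n → System S → ℚ
  satisfaction G R = mean (λ x → 𝟙 (satisfiedAt? G R x))

  violation : SGraph S n → System S → ℚ
  violation G R = mean (λ x → 𝟙 (¬? (satisfiedAt? G R x)))

  satisfaction-nonNeg : ∀ G R → 0ℚ ≤ satisfaction G R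
  satisfaction-nonNeg G R = mean-nonNeg (λ x → indicator-nonNeg (does (satisfiedAt? G R x)))

  violation-nonNeg : ∀ G R → 0ℚ ≤ violation G R
  violation-nonNeg G R = mean-nonNeg (λ x → indicator-nonNeg (does (¬? (satisfiedAt? G R x))))

  satisfaction+violation : ∀ G R → satisfaction G R + violation G R ≡ 1ℚ
  satisfaction+violation G R = begin
    satisfaction G R + violation G R
      ≡⟨ mean-+ (λ x → 𝟙 (satisfiedAt? G R x)) (λ x → 𝟙 (¬? (satisfiedAt? G R x))) ⟨
    mean (λ x → 𝟙 (satisfiedAt? G R x) + 𝟙 (¬? (satisfiedAt? G R x)))
      ≡⟨ mean-cong (λ x → indicator-not (does (satisfiedAt? G R x))) ⟩
    mean (λ _ → 1ℚ)
      ≡⟨ mean-const 1ℚ ⟩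
    1ℚ ∎
    where open ≡-Reasoning

  satisfaction-GSol : ∀ G R → GSol R G → satisfaction G R ≡ 1ℚ
  satisfaction-GSol G R solves =
    trans (mean-cong λ x → 𝟙-true (satisfiedAt? G R x) (All.tabulate λ r∈R → solves r∈R x))
          (mean-const 1ℚ)

  spotCheck : ∀ {q} R k → Algorithm S n q → Algorithm S n (fold q (checkCost S R) k)
  spotCheck R zero    A = A
  spotCheck R (suc k) A = random n (λ x → check R x (spotCheck R k A))

  -- Each round draws a fresh vertex, and what follows does not depend on it. Hence the average over
  -- that vertex factors out.
  Pr-spotCheck : ∀ {q} R k (A : Algorithm S n q) G →
                 Pr accept (spotCheck R k A) G ≡ satisfaction G R ^ k * Pr accept A G
  Pr-spotCheck R zero    A G = sym (*-identityˡ _)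
  Pr-spotCheck R (suc k) A G = begin
    mean (λ x → Pr accept (check R x (spotCheck R k A)) G)
      ≡⟨ mean-cong (λ x → Pr-check R x (spotCheck R k A) G) ⟩
    mean (λ x → 𝟙 (satisfiedAt? G R x) * Pr accept (spotCheck R k A) G)
      ≡⟨ mean-*ʳ (λ x → 𝟙 (satisfiedAt? G R x)) _ ⟩
    satisfaction G R * Pr accept (spotCheck R k A) G
      ≡⟨ cong (satisfaction G R *_) (Pr-spotCheck R k A G) ⟩
    satisfaction G R * (satisfaction G R ^ k * Pr accept A G)
      ≡⟨ *-assoc (satisfaction G R) (satisfaction G R ^ k) (Pr accept A G) ⟨
    satisfaction G R ^ suc k * Pr accept A G ∎
    where open ≡-Reasoning

-- Simulating queries to a pulled-back graph

length-inverse : ∀ {A : Set} (w : Word A) → length (inverse w) ≡ length w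
length-inverse w = trans (length-map flip± (reverse w)) (length-reverse w)

module _ {S T : Alphabet} (σ : Letter S → Word (Letter T))
         {L : ℕ} (∣σ∣≤L : ∀ s → length (σ s) ℕ.≤ L) {n : ℕ} where

  length-image± : ∀ s → length (image± σ s) ℕ.≤ L
  length-image± (s ⁺) = ∣σ∣≤L s
  length-image± (s ⁻) = ℕ.≤-trans (ℕ.≤-reflexive (length-inverse (σ s))) (∣σ∣≤L s)

  simulate : ∀ {q} → Algorithm S n q → Algorithm T n (q ℕ.* L)
  simulate         (output v)    = output v
  simulate         (random m A)  = random m (λ i → simulate (A i))
  simulate {suc q} (query s x A) =
    -- Every walk is charged the same `L` queries, whichever letter was asked for, which gives the
    -- bound `q * L`.
    weaken (ℕ.+-monoˡ-≤ (q ℕ.* L) (length-image± s))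
           (walk (image± σ s) x (λ y → simulate (A y)))

  Pr-simulate : ∀ {q} (A : Algorithm S n q) H →
                Pr accept (simulate A) H ≡ Pr accept A (pull σ H)
  Pr-simulate (output accept) H = refl
  Pr-simulate (output reject) H = refl
  Pr-simulate (random m A) H = mean-cong (λ i → Pr-simulate (A i) H)
  Pr-simulate (query s x A) H = begin
    Pr accept (simulate (query s x A)) H
      ≡⟨ Pr-weaken _ (walk (image± σ s) x (λ y → simulate (A y))) H ⟩
    Pr accept (walk (image± σ s) x (λ y → simulate (A y))) H
      ≡⟨ Pr-walk (image± σ s) x _ H ⟩
    Pr accept (simulate (A (act H (image± σ s) x))) H
      ≡⟨ Pr-simulate (A (act H (image± σ s) x)) H ⟩
    Pr accept (A (act H (image± σ s) x)) (pull σ H)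
      ≡⟨ cong (λ y → Pr accept (A y) (pull σ H)) (step-pull σ H s x) ⟨
    Pr accept (A (step (pull σ H) s x)) (pull σ H) ∎
    where open ≡-Reasoning

letter : (S : Alphabet) → Fin (size S) → Letter S
letter S = Inverse.from (letters S)

letter-surjective : (S : Alphabet) (s : Letter S) →
                    letter S (Inverse.to (letters S) s) ≡ s
letter-surjective S = Inverse.strictlyInverseʳ (letters S)

bounded : (S : Alphabet) (f : Letter S → ℕ) → ∃[ L ] ∀ s → f s ℕ.≤ L
-- The default 0 serves the empty alphabet.
bounded S f = max 0 values , λ s →
  All.lookup (xs≤max 0 values)
    (subst (λ t → f t ∈ values) (letter-surjective S s)
      (∈-map⁺ (f ∘ letter S) (∈-allFin (Inverse.to (letters S) s))))
  where
  values : List ℕ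
  values = map (f ∘ letter S) (allFin (size S))

-- Distances

module _ {S : Alphabet} {n : ℕ} .{{_ : NonZero n}} (G G′ : SGraph S n) where

  differ : Word (Letter S) → Fin n → ℚ
  differ w x = 𝟙 (¬? (act G w x ≟ act G′ w x))

  differ-nonNeg : ∀ w x → 0ℚ ≤ differ w x
  differ-nonNeg w x = indicator-nonNeg (does (¬? (act G w x ≟ act G′ w x)))

  dᵂ : Word (Letter S) → ℚ
  dᵂ w = mean (differ w)

  dᴴ≡∑dᵂ : dᴴ G G′ ≡ sum (λ i → dᵂ (letter S i ⁺ ∷ []))
  dᴴ≡∑dᵂ = sum-cong-≗ λ i →
    count/n (λ x → ¬? (act G (letter S i ⁺ ∷ []) x ≟ act G′ (letter S i ⁺ ∷ []) x)) id n

  dᴴ-nonNeg : 0ℚ ≤ dᴴ G G′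
  dᴴ-nonNeg = subst (0ℚ ≤_) (sym dᴴ≡∑dᵂ)
    (sum-nonNeg λ i → mean-nonNeg (differ-nonNeg (letter S i ⁺ ∷ [])))

  dᵂ-⁺ : ∀ s → dᵂ (s ⁺ ∷ []) ≤ dᴴ G G′
  dᵂ-⁺ s = begin
    dᵂ (s ⁺ ∷ [])
      ≡⟨ cong (λ t → dᵂ (t ⁺ ∷ [])) (letter-surjective S s) ⟨
    dᵂ (letter S i ⁺ ∷ [])
      ≤⟨ term≤sum (λ j → mean-nonNeg (differ-nonNeg (letter S j ⁺ ∷ []))) i ⟩
    sum (λ j → dᵂ (letter S j ⁺ ∷ []))
      ≡⟨ dᴴ≡∑dᵂ ⟨
    dᴴ G G′ ∎
    where
    open ≤-Reasoning
    i : Fin (size S)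
    i = Inverse.to (letters S) s

  -- Reindex by the permutation `s ⁻` of `G`, with `y` the image of `x`. If `s` moves `y` alike in
  -- both graphs, it moves `y` to `x` in both, so the inverses agree at `x`.
  dᵂ-⁻ : ∀ s → dᵂ (s ⁻ ∷ []) ≤ dᵂ (s ⁺ ∷ [])
  dᵂ-⁻ s = begin
    dᵂ (s ⁻ ∷ [])
      ≤⟨ mean-mono pointwise ⟩
    mean (differ (s ⁺ ∷ []) ∘ act G (s ⁻ ∷ []))
      ≡⟨ mean-permute (differ (s ⁺ ∷ [])) (actPermutation G (s ⁻ ∷ [])) ⟩
    dᵂ (s ⁺ ∷ []) ∎
    where
    open ≤-Reasoning
    pointwise : ∀ x → differ (s ⁻ ∷ []) x ≤ differ (s ⁺ ∷ []) (act G (s ⁻ ∷ []) x)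
    pointwise x = 𝟙-¬-antimono
      (step G (s ⁻) x ≟ step G′ (s ⁻) x)
      (step G (s ⁺) y ≟ step G′ (s ⁺) y)
      λ sy≡s′y → sym (trans
        (cong (step G′ (s ⁻)) (trans (sym (step-flip± G (s ⁺) x)) sy≡s′y))
        (step-flip± G′ (s ⁻) y))
      where y = step G (s ⁻) x

  dᵂ-letter : ∀ s → dᵂ (s ∷ []) ≤ dᴴ G G′
  dᵂ-letter (s ⁺) = dᵂ-⁺ s
  dᵂ-letter (s ⁻) = ≤-trans (dᵂ-⁻ s) (dᵂ-⁺ s)

  -- Triangle inequality through the point reached by `w` in `G` and then `s` in `G′`. As `w`
  -- permutes the vertices of `G`, composing with it leaves the mean for `s` unchanged.
  dᵂ-∷ : ∀ s w → dᵂ (s ∷ w) ≤ dᵂ (s ∷ []) + dᵂ w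
  dᵂ-∷ s w = begin
    dᵂ (s ∷ w)
      ≤⟨ mean-mono pointwise ⟩
    mean (λ x → differ (s ∷ []) (act G w x) + differ w x)
      ≡⟨ mean-+ (differ (s ∷ []) ∘ act G w) (differ w) ⟩
    mean (differ (s ∷ []) ∘ act G w) + dᵂ w
      ≡⟨ cong (_+ dᵂ w) (mean-permute (differ (s ∷ [])) (actPermutation G w)) ⟩
    dᵂ (s ∷ []) + dᵂ w ∎
    where
    open ≤-Reasoning
    pointwise : ∀ x → differ (s ∷ w) x ≤ differ (s ∷ []) (act G w x) + differ w x
    pointwise x = 𝟙-¬-∩
      (step G s (act G w x) ≟ step G′ s (act G w x))
      (act G w x ≟ act G′ w x)
      (act G (s ∷ w) x ≟ act G′ (s ∷ w) x)
      (λ sy≡s′y y≡y′ → trans sy≡s′y (cong (step G′ s) y≡y′))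

  dᵂ≤length·dᴴ : ∀ w → dᵂ w ≤ length w · dᴴ G G′
  dᵂ≤length·dᴴ []      = ≤-reflexive (trans
    (mean-cong λ x → cong (indicator ∘ not) (dec-true (x ≟ x) refl)) (mean-const 0ℚ))
  dᵂ≤length·dᴴ (s ∷ w) =
    ≤-trans (dᵂ-∷ s w) (+-mono-≤ (dᵂ-letter s) (dᵂ≤length·dᴴ w))

-- Distance after a round trip

module _ {S T : Alphabet} (σ : Letter S → Word (Letter T)) (τ : Letter T → Word (Letter S)) where

  roundTrip : Fin (size T) → Word (Letter T) × Word (Letter T)
  roundTrip i = letter T i ⁺ ∷ [] , image σ (τ (letter T i))

  -- At a vertex satisfying these relations, every letter of `T` acts in `H` as it does in
  -- `pull τ (pull σ H)`.
  retraction : System T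
  retraction = map roundTrip (allFin (size T))

  module _ {n : ℕ} (H : SGraph T n) where

    retraction-GSol : (∀ t → act H (t ⁺ ∷ []) ≗ act H (image σ (τ t))) → GSol retraction H
    retraction-GSol h r∈R x with ∈-map⁻ roundTrip r∈R
    ... | i , _ , refl = h (letter T i) x

    module _ .{{_ : NonZero n}} {L : ℕ} (∣τ∣≤L : ∀ t → length (τ t) ℕ.≤ L) where

      -- Compare both graphs with `pull τ (pull σ H)`. For each letter `t`, the first comparison
      -- fails only at violating vertices, and the second costs at most one `dᴴ (pull σ H) G` per
      -- letter of `τ t`.
      dᴴ-pull-pull : (G : SGraph S n) → dᴴ H (pull {T} τ G) ≤
                     size T · (violation H retraction + L · dᴴ (pull σ H) G)
      dᴴ-pull-pull G = begin
        dᴴ H (pull {T} τ G)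
          ≡⟨ dᴴ≡∑dᵂ H (pull τ G) ⟩
        sum (λ i → dᵂ H (pull τ G) (letter T i ⁺ ∷ []))
          ≤⟨ sum-mono term ⟩
        sum {size T} (λ _ → violation H retraction + L · dᴴ (pull σ H) G)
          ≡⟨ sum-replicate (size T) ⟩
        size T · (violation H retraction + L · dᴴ (pull σ H) G) ∎
        where
        open ≤-Reasoning

        pointwise : ∀ i x → differ H (pull τ G) (letter T i ⁺ ∷ []) x ≤
          𝟙 (¬? (satisfiedAt? H retraction x)) + differ (pull σ H) G (τ (letter T i)) x
        pointwise i x = 𝟙-¬-∩
          (satisfiedAt? H retraction x)
          (act (pull σ H) (τ t) x ≟ act G (τ t) x)
          (act H (t ⁺ ∷ []) x ≟ act (pull {T} τ G) (t ⁺ ∷ []) x)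
          (λ sat agree → trans
            (All.lookup sat (∈-map⁺ roundTrip (∈-allFin i)))
            (trans (sym (act-pull σ H (τ t) x)) agree))
          where t = letter T i

        term : ∀ i → dᵂ H (pull τ G) (letter T i ⁺ ∷ []) ≤
                     violation H retraction + L · dᴴ (pull σ H) G
        term i = begin
          dᵂ H (pull τ G) (letter T i ⁺ ∷ [])
            ≤⟨ mean-mono (pointwise i) ⟩
          mean (λ x → 𝟙 (¬? (satisfiedAt? H retraction x)) + differ (pull σ H) G w x)
            ≡⟨ mean-+ (λ x → 𝟙 (¬? (satisfiedAt? H retraction x))) (differ (pull σ H) G w) ⟩
          violation H retraction + dᵂ (pull σ H) G w
            ≤⟨ +-monoʳ-≤ (violation H retraction) (dᵂ≤length·dᴴ (pull σ H) G w) ⟩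
          violation H retraction + length w · dᴴ (pull σ H) G
            ≤⟨ +-monoʳ-≤ (violation H retraction)
                 (·-monoˡ (dᴴ-nonNeg (pull σ H) G) (∣τ∣≤L (letter T i))) ⟩
          violation H retraction + L · dᴴ (pull σ H) G ∎
          where w = τ (letter T i)

-- The combined tester

module _ {S T : Alphabet} {E₁ : System S} {E₂ : System T}
         {f : Word (Letter S) → Word (Letter T)}
         (f-iso : IsGroupIsomorphism (rawGroup (Γ S E₁)) (rawGroup (Γ T E₂)) f) where
  private
    module f = IsGroupIsomorphism f-iso
    module Γ₂ = Group (Γ T E₂)

    g-iso : Γ T E₂ ≅ Γ S E₁
    g-iso = ≅-sym {Γ S E₁} {Γ T E₂} (f , f-iso)

    module g = IsGroupIsomorphism (proj₂ g-iso)

    σ : Letter S → Word (Letter T)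
    σ s = f (s ⁺ ∷ [])

    τ : Letter T → Word (Letter S)
    τ t = proj₁ g-iso (t ⁺ ∷ [])

    σ-pull : ∀ {n} {H : SGraph T n} → GSol E₂ H → GSol E₁ (pull {S} σ H)
    σ-pull {H = H} = pull-GSol {E₁ = E₁} {E₂ = E₂} f.isGroupHomomorphism {H = H}

    τ-pull : ∀ {n} {G : SGraph S n} → GSol E₁ G → GSol E₂ (pull {T} τ G)
    τ-pull {G = G} = pull-GSol {E₁ = E₂} {E₂ = E₁} g.isGroupHomomorphism {H = G}

    -- `τ t` is the preimage of `t` under `f` picked by surjectivity, and `hom-image` replaces `f`
    -- by substitution.
    σ∘τ : ∀ t → (t ⁺ ∷ []) Γ₂.≈ image σ (τ t)
    σ∘τ t = begin
      t ⁺ ∷ []       ≈⟨ proj₂ (f.surjective (t ⁺ ∷ [])) {τ t} (Group.refl (Γ S E₁) {τ t}) ⟨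
      f (τ t)        ≈⟨ hom-image {S} {T} {E₁ = E₁} {E₂ = E₂} f.isGroupHomomorphism (τ t) ⟩
      image σ (τ t)  ∎
      where open SetoidReasoning Γ₂.setoid

    R : System T
    R = retraction {S} {T} σ τ

    retraction-solved : ∀ {n} {H : SGraph T n} → GSol E₂ H → GSol R H
    retraction-solved {H = H} solves = retraction-GSol {S} {T} σ τ H
      (λ t → act-Γ {E = E₂} H solves {t ⁺ ∷ []} {image σ (τ t)} (σ∘τ t))

  module _
    {M L : ℕ} (∣σ∣≤M : ∀ s → length (σ s) ℕ.≤ M) (∣τ∣≤L : ∀ t → length (τ t) ℕ.≤ L)
    -- If the violation and the distance to a solution of `E₁` are both below `η`, each letter of
    -- `T` contributes at most `η + L · η`, that is `suc L · η`.
    {ε η : ℚ} (0<η : 0ℚ < η) (η-small : (size T ℕ.* suc L) · η < ε)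
    {k : ℕ} (ρᵏ≤1/100 : ∀ {ρ} → 0ℚ ≤ ρ → ρ + η ≤ 1ℚ → ρ ^ k ≤ + 1 / 100)
    {q : ℕ} (tester₁ : Tester S E₁ η q)
    where
    open ≤-Reasoning
    module Tester₁ = Tester tester₁

    combined : ∀ n .{{_ : NonZero n}} → Algorithm T n (fold (q ℕ.* M) (checkCost T R) k)
    combined n = spotCheck R k (simulate {S} {T} σ ∣σ∣≤M (Tester₁.algorithm n))

    module _ (n : ℕ) .{{_ : NonZero n}} (H : SGraph T n) where
      private
        A₁ : Algorithm S n q
        A₁ = Tester₁.algorithm n

        G : SGraph S n
        G = pull {S} σ H

        ρ β p : ℚ
        ρ = satisfaction H R
        β = violation H R
        p = Pr accept A₁ G

        0≤ρ : 0ℚ ≤ ρ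
        0≤ρ = satisfaction-nonNeg H R

        ρ+β≡1 : ρ + β ≡ 1ℚ
        ρ+β≡1 = satisfaction+violation H R

      Pr-combined : Pr accept (combined n) H ≡ ρ ^ k * p
      Pr-combined = trans
        (Pr-spotCheck R k (simulate {S} {T} σ ∣σ∣≤M A₁) H)
        (cong (ρ ^ k *_) (Pr-simulate {S} {T} σ ∣σ∣≤M A₁ H))

      -- The spot checks never reject a solution, so they use up none of the permitted error.
      combined-accepts : GSol E₂ H → + 99 / 100 ≤ Pr accept (combined n) H
      combined-accepts solves = begin
        + 99 / 100                ≤⟨ Tester₁.accepts n G (σ-pull {H = H} solves) ⟩
        p                         ≡⟨ *-identityˡ p ⟨
        1ℚ * p                    ≡⟨ cong (_* p) (1^ k) ⟨
        1ℚ ^ k * p                ≡⟨ cong (λ r → r ^ k * p) ρ≡1 ⟨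
        ρ ^ k * p                 ≡⟨ Pr-combined ⟨
        Pr accept (combined n) H  ∎
        where
        ρ≡1 : ρ ≡ 1ℚ
        ρ≡1 = satisfaction-GSol H R (retraction-solved {H = H} solves)

        1^ : ∀ k → 1ℚ ^ k ≡ 1ℚ
        1^ zero    = refl
        1^ (suc k) = trans (*-identityˡ (1ℚ ^ k)) (1^ k)

      -- A solution of `E₁` closer than `η` to `G` would pull back along `τ` to a solution of `E₂`
      -- closer than `ε` to `H`.
      pull-far : β < η → GSol≥ ε E₂ H → GSol≥ η E₁ G
      pull-far β<η far G′ solves = ≮⇒≥ λ d<η → <-irrefl refl (begin-strict
        ε                             ≤⟨ far (pull {T} τ G′) (τ-pull {G = G′} solves) ⟩
        dᴴ H (pull {T} τ G′)          ≤⟨ dᴴ-pull-pull {S} {T} σ τ H ∣τ∣≤L G′ ⟩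
        size T · (β + L · dᴴ G G′)    ≤⟨ ·-monoʳ (size T) (+-mono-≤ (<⇒≤ β<η)
                                                                    (·-monoʳ L (<⇒≤ d<η))) ⟩
        size T · (suc L · η)          ≡⟨ ×-assocˡ η (size T) (suc L) ⟩
        (size T ℕ.* suc L) · η        <⟨ η-small ⟩
        ε                             ∎)

      Pr-combined-far : GSol≥ ε E₂ H → ρ ^ k * p ≤ + 1 / 100
      Pr-combined-far far with η ≤? β
      -- Many violations: the spot checks alone push acceptance down to 1/100.
      ... | yes η≤β = begin
        ρ ^ k * p   ≤⟨ *-monoˡ (^-nonNeg 0≤ρ k) (Pr-≤1 A₁ G) ⟩
        ρ ^ k * 1ℚ  ≡⟨ *-identityʳ (ρ ^ k) ⟩
        ρ ^ k       ≤⟨ ρᵏ≤1/100 0≤ρ (≤-trans (+-monoʳ-≤ ρ η≤β) (≤-reflexive ρ+β≡1)) ⟩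
        + 1 / 100   ∎
      -- Few violations: `G` is far from solving `E₁`, and the simulated tester alone suffices.
      ... | no η≰β = begin
        ρ ^ k * p   ≤⟨ *-monoʳ (Pr-nonNeg A₁ G) (^-≤1 0≤ρ ρ≤1 k) ⟩
        1ℚ * p      ≡⟨ *-identityˡ p ⟩
        p           ≤⟨ complement-antimono {+ 99 / 100} {+ 1 / 100} refl
                         (trans (+-comm (Pr reject A₁ G) p) (Pr-total A₁ G))
                         (Tester₁.rejects n G (pull-far (≰⇒> η≰β) far)) ⟩
        + 1 / 100   ∎
        where
        ρ≤1 : ρ ≤ 1ℚ
        ρ≤1 = ≤-trans (p≤p+q ρ (violation-nonNeg H R)) (≤-reflexive ρ+β≡1)

      combined-rejects : GSol≥ ε E₂ H → + 99 / 100 ≤ Pr reject (combined n) H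
      combined-rejects far =
        complement-antimono {p′ = + 1 / 100} {+ 99 / 100} (Pr-total (combined n) H) refl
          (≤-trans (≤-reflexive Pr-combined) (Pr-combined-far far))

  testable-transfer : Testable S E₁ → Testable T E₂
  testable-transfer E₁-testable ε 0<ε =
    -- The word lengths and `ε` determine `η`, and `η` determines `k` and `q`. All are fixed before
    -- `n`, hence so is the query bound.
    let M , ∣σ∣≤M         = bounded S (length ∘ σ)
        L , ∣τ∣≤L         = bounded T (length ∘ τ)
        η , 0<η , η-small = ∃-multiple< (size T ℕ.* suc L) 0<ε
        k , ρᵏ≤1/100      = ^-vanishing 0<η
        q , tester₁       = E₁-testable η 0<η
    in fold (q ℕ.* M) (checkCost T R) k , record
      { algorithm = combined ∣σ∣≤M ∣τ∣≤L 0<η η-small {k} ρᵏ≤1/100 tester₁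
      ; accepts   = combined-accepts ∣σ∣≤M ∣τ∣≤L 0<η η-small {k} ρᵏ≤1/100 tester₁
      ; rejects   = combined-rejects ∣σ∣≤M ∣τ∣≤L 0<η η-small {k} ρᵏ≤1/100 tester₁
      }

proposition3p2 : (S T : Alphabet) (E₁ : System S) (E₂ : System T) →
    Γ S E₁ ≅ Γ T E₂ → Testable S E₁ ⇔ Testable T E₂
proposition3p2 S T E₁ E₂ iso = mk⇔
  (testable-transfer {S} {T} {E₁} {E₂} (proj₂ iso))
  (testable-transfer {T} {S} {E₂} {E₁} (proj₂ (≅-sym {Γ S E₁} {Γ T E₂} iso)))
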